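{- Let $L$ be an infinite countable discrete indecomposable scattered linear order of finite Hausdorff rank. Then there is an alternating signed tree $(T,s_T)$ such that $L$ and $\mathrm{LIN}(T,s_T)$ are equimorphic.
   Context: Trees: a finite tree is a nonempty finite set $T\subseteq\omega^{<\omega}$ closed under initial segments, root $\emptyset$, $\sigma*x$ is $\sigma$ extended by $x$; in standard labelling, with $w(T;\sigma)$ the number of children of $\sigma$, $\sigma*x\in T$ iff $x<w(T;\sigma)$. A finite signed tree is $(T,s_T)$ with $s_T:T\to\{+,-\}$. It is alternating if for every $\sigma\in T$, $w(T;\sigma)$ is even and $s_T(\sigma*x)=(-1)^x$ (i.e. $+$ for even $x$, $-$ for odd $x$) for every $x<w(T;\sigma)$. $A\times B$ denotes the lexicographic product $\sum_{a\in A}B$ (first coordinate dominant); $\omega^+:=\omega$, $\omega^-:=\omega^*$ (reverse of $\omega$). $\mathrm{LIN}(T,s_T,\sigma):=\omega^{s_T(\sigma)}\times\big(\sum_{x<w(T;\sigma)}\mathrm{LIN}(T,s_T,\sigma*x)\big)$, the empty sum being $\mathbf 1$, and $\mathrm{LIN}(T,s_T):=\mathrm{LIN}(T,s_T,\emptyset)$. Two linear orders are equimorphic if each embeds (order-preservingly and injectively) into the other. Discrete: every non-maximum element has an immediate successor and every non-minimum element has an immediate predecessor. Indecomposable: whenever $L$ embeds into $A+B$, $L$ embeds into $A$ or into $B$. Scattered: $\mathbb Q$ does not embed. Hausdorff rank: $\sim_0$ is equality; for $\alpha>0$ and $x<y$, $x\sim_\alpha y$ iff for some $\beta<\alpha$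 only finitely many $\sim_\beta$-classes meet $[x,y]$; $\mathrm{rk}(L)$ is the least $\alpha$ such that the set of $\sim_\alpha$-classes is finite. -}

module Defs where

open import Level using (0ℓ)
open import Data.Nat using (ℕ; zero; suc)
import Data.Nat as ℕ
open import Data.Fin using (Fin)
open import Data.Rational using (ℚ)
import Data.Rational as ℚ
open import Data.Empty using (⊥)
open import Data.Unit using (⊤)
open import Data.Sum using (_⊎_; inj₁; inj₂)
open import Data.Product using (Σ; _×_; _,_; ∃)
open import Data.List using (List; []; _∷_; length)
open import Data.List.Relation.Unary.Any using (Any)
open import Relation.Nullary using (¬_)
open import Relation.Binary.PropositionalEquality using (_≡_)
open import Relation.Binary.Structures using (IsStrictTotalOrder)
open import Function.Bundles using (_↔_)

record Ord : Set₁ where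
  constructor mkOrd
  field
    Car : Set
    lt  : Car → Car → Set

open Ord public

record Emb (P Q : Ord) : Set where
  field
    fun  : Car P → Car Q
    mono : ∀ x y → lt P x y → lt Q (fun x) (fun y)
    inj  : ∀ x y → fun x ≡ fun y → x ≡ y

Equimorphic : Ord → Ord → Set
Equimorphic P Q = Emb P Q × Emb Q P

record LinOrder : Set₁ where
  field
    Carrier : Set
    _<_     : Carrier → Carrier → Set
    isSTO   : IsStrictTotalOrder _≡_ _<_

toOrd : LinOrder → Ord
toOrd L = mkOrd (LinOrder.Carrier L) (LinOrder._<_ L)

sumLt : {A B : Set} → (A → A → Set) → (B → B → Set) → A ⊎ B → A ⊎ B → Set
sumLt la lb (inj₁ a) (inj₁ a') = la a a'
sumLt la lb (inj₁ a) (inj₂ b)  = ⊤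
sumLt la lb (inj₂ b) (inj₁ a)  = ⊥
sumLt la lb (inj₂ b) (inj₂ b') = lb b b'

_⊕_ : Ord → Ord → Ord
P ⊕ Q = mkOrd (Car P ⊎ Car Q) (sumLt (lt P) (lt Q))

_⊗_ : Ord → Ord → Ord
P ⊗ Q = mkOrd (Car P × Car Q) lexLt
  where
  lexLt : Car P × Car Q → Car P × Car Q → Set
  lexLt (a , b) (a' , b') = lt P a a' ⊎ (a ≡ a' × lt Q b b')

ωOrd : Ord
ωOrd = mkOrd ℕ ℕ._<_

ω*Ord : Ord
ω*Ord = mkOrd ℕ (λ m n → n ℕ.< m)

oneOrd : Ord
oneOrd = mkOrd ⊤ (λ _ _ → ⊥)

emptyOrd : Ord
emptyOrd = mkOrd ⊥ (λ _ _ → ⊥)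

ℚOrd : Ord
ℚOrd = mkOrd ℚ ℚ._<_

-- Finite signed trees in standard labelling, as finite rose trees:
-- the children of a node are listed in order, child number x being σ*x.

data Sign : Set where
  plus minus : Sign

data STree : Set where
  node : Sign → List STree → STree

altSign : ℕ → Sign
altSign zero          = plus
altSign (suc zero)    = minus
altSign (suc (suc n)) = altSign n

data Even : ℕ → Set where
  even0  : Even zero
  even+2 : ∀ {n} → Even n → Even (suc (suc n))

sign : STree → Sign
sign (node s _) = s

mutual
  Alternating : STree → Set
  Alternating (node s cs) = Even (length cs) × AltChildren 0 cs

  AltChildren : ℕ → List STree → Set
  AltChildren x []       = ⊤
  AltChildren x (c ∷ cs) = (sign c ≡ altSign x) × Alternating c × AltChildren (suc x) cs

ωPow : Sign → Ord
ωPow plus  = ωOrd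
ωPow minus = ω*Ord

mutual
  -- LIN(T,s_T,σ) = ω^{s(σ)} × (Σ_{x<w} LIN(T,s_T,σ*x)), empty sum = 1
  LIN : STree → Ord
  LIN (node s [])       = ωPow s ⊗ oneOrd
  LIN (node s (c ∷ cs)) = ωPow s ⊗ sumLIN (c ∷ cs)

  sumLIN : List STree → Ord
  sumLIN []       = emptyOrd
  sumLIN (c ∷ cs) = LIN c ⊕ sumLIN cs

module _ (L : LinOrder) where
  open LinOrder L

  _≤_ : Carrier → Carrier → Set
  x ≤ y = x < y ⊎ x ≡ y

  Countable : Set
  Countable = Σ (Carrier → ℕ) λ f → ∀ x y → f x ≡ f y → x ≡ y

  Finite : Set
  Finite = Σ ℕ λ n → Carrier ↔ Fin n

  Infinite : Set
  Infinite = ¬ Finite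

  ImmSucc : Carrier → Carrier → Set
  ImmSucc x s = x < s × (∀ z → x < z → z < s → ⊥)

  ImmPred : Carrier → Carrier → Set
  ImmPred x p = p < x × (∀ z → p < z → z < x → ⊥)

  Discrete : Set
  Discrete = (∀ x → (∃ λ y → x < y) → ∃ λ s → ImmSucc x s)
           × (∀ x → (∃ λ y → y < x) → ∃ λ p → ImmPred x p)

  Indecomposable : Set₁
  Indecomposable = (A B : LinOrder) → Emb (toOrd L) (toOrd A ⊕ toOrd B)
                 → Emb (toOrd L) (toOrd A) ⊎ Emb (toOrd L) (toOrd B)

  Scattered : Set
  Scattered = ¬ Emb ℚOrd (toOrd L)

  -- "only finitely many R-classes meet [x,y]": finitely many
  -- representatives whose classes cover [x,y]
  FinMeet : (Carrier → Carrier → Set) → Carrier → Carrier → Set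
  FinMeet R x y = Σ (List Carrier) λ reps →
                    ∀ z → x ≤ z → z ≤ y → Any (R z) reps

  mutual
    Sim : ℕ → Carrier → Carrier → Set
    Sim zero    x y = x ≡ y
    Sim (suc n) x y = x ≡ y ⊎ (x < y × Close n x y) ⊎ (y < x × Close n y x)

    -- Close n x y : for some β ≤ n, only finitely many ∼_β classes meet [x,y]
    Close : ℕ → Carrier → Carrier → Set
    Close zero    x y = FinMeet (Sim zero) x y
    Close (suc n) x y = Close n x y ⊎ FinMeet (Sim (suc n)) x y

  FinitelyManyClasses : ℕ → Set
  FinitelyManyClasses n = Σ (List Carrier) λ reps → ∀ z → Any (Sim n z) reps

  FiniteHausdorffRank : Set
  FiniteHausdorffRank = Σ ℕ FinitelyManyClasses

{-# OPTIONS --safe #-}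
-- By induction on the rank, every interval of L inside one ∼ₙ-class embeds in a finite sum of points
-- and of orders LIN t, where t ranges over a fixed finite list of alternating trees and each LIN t
-- that occurs embeds back into the interval.  A half of a ∼ₙ₊₁-class without last element is an
-- ω- or ω*-sum of such intervals; let S be the set of trees of the list that embed in blocks
-- arbitrarily far out.  Beyond some block only members of S occur, so the remaining tail embeds in
-- ω^± × Σ S, which in turn embeds in the half.  If S is nonempty, infinite closed intervals occur
-- arbitrarily far out; discreteness puts both ω and ω* inside them, so leaves of both signs may be
-- added to S to make it alternate.  Applied to L itself, indecomposability selects one summand LIN t
-- in which L embeds.
module Submission where

open import Defs hiding (_≤_)
open import Level using (0ℓ)
open import Axiom.ExcludedMiddle using (ExcludedMiddle)
open import Data.Bool using (true; false)
open import Data.Empty using (⊥; ⊥-elim)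
open import Data.Fin using (zero; suc)
open import Data.List using (List; []; _∷_; _++_; map; filter; length; cartesianProductWith)
open import Data.List.Membership.Propositional using (_∈_)
open import Data.List.Membership.Propositional.Properties
  using (∈-++⁺ˡ; ∈-++⁺ʳ; ∈-map⁺; ∈-filter⁺; ∈-cartesianProductWith⁺)
open import Data.List.Relation.Unary.All as All using (All; []; _∷_)
import Data.List.Relation.Unary.All.Properties as All
open import Data.List.Relation.Unary.Any using (Any; here; there)
open import Data.Nat using (ℕ; zero; suc; _+_; _⊔_; _≤_; _<_; z≤n; s≤s)
open import Data.Nat.Properties as ℕ using (≤-refl; ≤-trans)
open import Data.Product using (Σ; ∃; _×_; _,_; proj₁; proj₂)
open import Data.Sum using (_⊎_; inj₁; inj₂; [_,_]′)
import Data.Sum as Sum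
open import Data.Unit using (⊤; tt)
open import Function.Base using (_∘_; id; flip)
open import Function.Bundles using (mk↔ₛ′)
open import Relation.Binary.Construct.Flip.EqAndOrd as Flip using ()
open import Relation.Binary.Definitions using (Tri; tri<; tri≈; tri>)
open import Relation.Binary.PropositionalEquality
  using (_≡_; refl; sym; trans; cong; subst; isEquivalence; setoid)
open import Relation.Binary.Structures using (IsStrictTotalOrder)
open import Relation.Binary.Structures.Biased using (isStrictTotalOrderᶜ)
open import Relation.Nullary using (¬_; yes; no; does; contradiction)
open import Relation.Unary using (Decidable)

-- Embeddings of orders.

-- Injectivity is left out: between strict total orders it follows from strict monotonicity, and
-- `≼⇒Emb` restores it at the end.
record _≼_ (P Q : Ord) : Set where
  constructor emb
  field
    to   : Car P → Car Q
    mono : ∀ x y → lt P x y → lt Q (to x) (to y)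

open _≼_

infix 4 _≼_

≼-refl : ∀ {P} → P ≼ P
≼-refl = emb id (λ _ _ p → p)

≼-trans : ∀ {P Q R} → P ≼ Q → Q ≼ R → P ≼ R
≼-trans f g = emb (to g ∘ to f) (λ x y p → mono g _ _ (mono f x y p))

inj₁-≼ : ∀ {P Q} → P ≼ P ⊕ Q
inj₁-≼ = emb inj₁ (λ _ _ p → p)

inj₂-≼ : ∀ {P Q} → Q ≼ P ⊕ Q
inj₂-≼ = emb inj₂ (λ _ _ p → p)

⊕-mono : ∀ {P P′ Q Q′} → P ≼ P′ → Q ≼ Q′ → P ⊕ Q ≼ P′ ⊕ Q′
⊕-mono f g = emb (Sum.map (to f) (to g)) λ where
  (inj₁ x) (inj₁ y) p → mono f x y p
  (inj₁ x) (inj₂ y) p → tt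
  (inj₂ x) (inj₂ y) p → mono g x y p

point≼ : ∀ {P} → Car P → oneOrd ≼ P
point≼ x = emb (λ _ → x) (λ _ _ ())

-- The empty order is included here, so `Built` can do without an empty summand.
antichain≼one : ∀ {P} → (∀ x y → ¬ lt P x y) → P ≼ oneOrd
antichain≼one h = emb (λ _ → tt) (λ x y p → h x y p)

-- Strict total orders: sums, products and `LIN`.

IsSTO : Ord → Set
IsSTO P = IsStrictTotalOrder _≡_ (lt P)

strictTotalOrder : ∀ {P} → (∀ x → ¬ lt P x x) → (∀ {x y z} → lt P x y → lt P y z → lt P x z) →
  (∀ x y → lt P x y ⊎ x ≡ y ⊎ lt P y x) → IsSTO P
strictTotalOrder {P} irr tr conn = isStrictTotalOrderᶜ record
  { isEquivalence = isEquivalence ; trans = tr ; compare = compare }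
  where
  compare : ∀ x y → Tri (lt P x y) (x ≡ y) (lt P y x)
  compare x y with conn x y
  ... | inj₁ p           = tri< p (λ { refl → irr _ p }) (λ q → irr _ (tr p q))
  ... | inj₂ (inj₁ refl) = tri≈ (irr _) refl (irr _)
  ... | inj₂ (inj₂ p)    = tri> (λ q → irr _ (tr p q)) (λ { refl → irr _ p }) p

connex : ∀ {P} → IsSTO P → ∀ x y → lt P x y ⊎ x ≡ y ⊎ lt P y x
connex sto x y with IsStrictTotalOrder.compare sto x y
... | tri< p _ _ = inj₁ p
... | tri≈ _ p _ = inj₂ (inj₁ p)
... | tri> _ _ p = inj₂ (inj₂ p)

irreflexive : ∀ {P} → IsSTO P → ∀ x → ¬ lt P x x
irreflexive sto x = IsStrictTotalOrder.irrefl sto refl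

one-isSTO : IsSTO oneOrd
one-isSTO = strictTotalOrder (λ _ ()) (λ ()) (λ _ _ → inj₂ (inj₁ refl))

dir : {A : Set} → Sign → (A → A → Set) → A → A → Set
dir plus  R = R
dir minus R = flip R

-- Unlike `ωPow s`, this has carrier ℕ before the sign is known, so both signs can be treated at
-- once.
Ω : Sign → Ord
Ω s = mkOrd ℕ (dir s _<_)

empty-isSTO : IsSTO emptyOrd
empty-isSTO = strictTotalOrder (λ _ ()) (λ ()) (λ ())

dir-isSTO : ∀ {P} s → IsSTO P → IsSTO (mkOrd (Car P) (dir s (lt P)))
dir-isSTO plus  p = p
dir-isSTO minus p = Flip.isStrictTotalOrder p

Ω-isSTO : ∀ s → IsSTO (Ω s)
Ω-isSTO s = dir-isSTO s ℕ.<-isStrictTotalOrder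

⊕-isSTO : ∀ {P Q} → IsSTO P → IsSTO Q → IsSTO (P ⊕ Q)
⊕-isSTO {P} {Q} p q = strictTotalOrder
  (λ { (inj₁ x) → irreflexive p x ; (inj₂ x) → irreflexive q x })
  (λ {x} {y} {z} → tr x y z) conn
  where
  tr : ∀ x y z → lt (P ⊕ Q) x y → lt (P ⊕ Q) y z → lt (P ⊕ Q) x z
  tr (inj₁ _) (inj₁ _) (inj₁ _) a b = IsStrictTotalOrder.trans p a b
  tr (inj₁ _) _        (inj₂ _) a b = tt
  tr (inj₂ _) (inj₂ _) (inj₂ _) a b = IsStrictTotalOrder.trans q a b
  conn : ∀ x y → lt (P ⊕ Q) x y ⊎ x ≡ y ⊎ lt (P ⊕ Q) y x
  conn (inj₁ x) (inj₁ y) = Sum.map₂ (Sum.map₁ (cong inj₁)) (connex p x y)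
  conn (inj₁ _) (inj₂ _) = inj₁ tt
  conn (inj₂ _) (inj₁ _) = inj₂ (inj₂ tt)
  conn (inj₂ x) (inj₂ y) = Sum.map₂ (Sum.map₁ (cong inj₂)) (connex q x y)

⊗-isSTO : ∀ {P Q} → IsSTO P → IsSTO Q → IsSTO (P ⊗ Q)
⊗-isSTO {P} {Q} p q = strictTotalOrder irr tr conn
  where
  irr : ∀ x → ¬ lt (P ⊗ Q) x x
  irr x (inj₁ a)       = irreflexive p _ a
  irr x (inj₂ (_ , b)) = irreflexive q _ b
  tr : ∀ {x y z} → lt (P ⊗ Q) x y → lt (P ⊗ Q) y z → lt (P ⊗ Q) x z
  tr (inj₁ a)          (inj₁ b)          = inj₁ (IsStrictTotalOrder.trans p a b)
  tr (inj₁ a)          (inj₂ (refl , b)) = inj₁ a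
  tr (inj₂ (refl , a)) (inj₁ b)          = inj₁ b
  tr (inj₂ (refl , a)) (inj₂ (refl , b)) = inj₂ (refl , IsStrictTotalOrder.trans q a b)
  conn : ∀ x y → lt (P ⊗ Q) x y ⊎ x ≡ y ⊎ lt (P ⊗ Q) y x
  conn (a , b) (a′ , b′) with connex p a a′
  ... | inj₁ l           = inj₁ (inj₁ l)
  ... | inj₂ (inj₂ l)    = inj₂ (inj₂ (inj₁ l))
  ... | inj₂ (inj₁ refl) with connex q b b′
  ...   | inj₁ l           = inj₁ (inj₂ (refl , l))
  ...   | inj₂ (inj₁ refl) = inj₂ (inj₁ refl)
  ...   | inj₂ (inj₂ l)    = inj₂ (inj₂ (inj₂ (refl , l)))

-- The case `oneOrd` belongs to leaves; with it `LIN-node` covers leaves and inner nodes by one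
-- formula.
body : List STree → Ord
body []       = oneOrd
body (c ∷ cs) = sumLIN (c ∷ cs)

LIN-node : ∀ s cs → LIN (node s cs) ≡ Ω s ⊗ body cs
LIN-node plus  []       = refl
LIN-node plus  (c ∷ cs) = refl
LIN-node minus []       = refl
LIN-node minus (c ∷ cs) = refl

mutual
  LIN-isSTO : ∀ t → IsSTO (LIN t)
  LIN-isSTO (node s cs) = subst IsSTO (sym (LIN-node s cs)) (⊗-isSTO (Ω-isSTO s) (body-isSTO cs))

  body-isSTO : ∀ cs → IsSTO (body cs)
  body-isSTO []       = one-isSTO
  body-isSTO (c ∷ cs) = ⊕-isSTO (LIN-isSTO c) (sumLIN-isSTO cs)

  sumLIN-isSTO : ∀ cs → IsSTO (sumLIN cs)
  sumLIN-isSTO []       = empty-isSTO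
  sumLIN-isSTO (c ∷ cs) = ⊕-isSTO (LIN-isSTO c) (sumLIN-isSTO cs)

≼⇒Emb : ∀ {P Q} → IsSTO P → IsSTO Q → P ≼ Q → Emb P Q
≼⇒Emb {P} {Q} p q f = record { fun = to f ; mono = mono f ; inj = inj }
  where
  inj : ∀ x y → to f x ≡ to f y → x ≡ y
  inj x y eq with connex p x y
  ... | inj₁ l           = contradiction (subst (lt Q (to f x)) (sym eq) (mono f x y l)) (irreflexive q _)
  ... | inj₂ (inj₁ refl) = refl
  ... | inj₂ (inj₂ l)    = contradiction (subst (lt Q (to f y)) eq (mono f y x l)) (irreflexive q _)

Emb⇒≼ : ∀ {P Q} → Emb P Q → P ≼ Q
Emb⇒≼ f = emb (Emb.fun f) (Emb.mono f)

-- Leaves, inhabitants and alternating lists of children.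

leaf : Sign → STree
leaf s = node s []

mutual
  LIN-inhabited : ∀ t → Car (LIN t)
  LIN-inhabited (node s cs) = subst Car (sym (LIN-node s cs)) (0 , body-inhabited cs)

  body-inhabited : ∀ cs → Car (body cs)
  body-inhabited []      = tt
  body-inhabited (c ∷ _) = inj₁ (LIN-inhabited c)

LIN≼body : ∀ {t cs} → t ∈ cs → LIN t ≼ body cs
LIN≼body {cs = _ ∷ _} (here refl)           = inj₁-≼
LIN≼body {cs = _ ∷ _ ∷ _} (there t∈) = ≼-trans (LIN≼body t∈) inj₂-≼

Ω≼LIN : ∀ t → Ω (sign t) ≼ LIN t
Ω≼LIN (node s cs) = subst (Ω s ≼_) (sym (LIN-node s cs))
  (emb (λ k → k , body-inhabited cs) (λ _ _ → inj₁))

-- Children are inserted in pairs, each tree completed by a leaf of the opposite sign.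
pad : List STree → List STree
pad []                   = []
pad (node plus cs ∷ ts)  = node plus cs ∷ leaf minus ∷ pad ts
pad (node minus cs ∷ ts) = leaf plus ∷ node minus cs ∷ pad ts

pad-even : ∀ ts → Even (length (pad ts))
pad-even []                  = even0
pad-even (node plus _ ∷ ts)  = even+2 (pad-even ts)
pad-even (node minus _ ∷ ts) = even+2 (pad-even ts)

leaf-alternating : ∀ s → Alternating (leaf s)
leaf-alternating s = even0 , tt

AltChildren+2 : ∀ x cs → AltChildren x cs → AltChildren (suc (suc x)) cs
AltChildren+2 x []       _             = tt
AltChildren+2 x (c ∷ cs) (p , q , r) = p , q , AltChildren+2 (suc x) cs r

pad-alternating : ∀ {ts} → All Alternating ts → AltChildren 0 (pad ts)
pad-alternating [] = tt
pad-alternating {node plus _ ∷ ts} (a ∷ as) =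
  refl , a , refl , leaf-alternating minus , AltChildren+2 0 (pad ts) (pad-alternating as)
pad-alternating {node minus _ ∷ ts} (a ∷ as) =
  refl , leaf-alternating plus , refl , a , AltChildren+2 0 (pad ts) (pad-alternating as)

∈-pad : ∀ {t ts} → t ∈ ts → t ∈ pad ts
∈-pad {ts = node plus _ ∷ _}  (here refl) = here refl
∈-pad {ts = node minus _ ∷ _} (here refl) = there (here refl)
∈-pad {ts = node plus _ ∷ _}  (there t∈)  = there (there (∈-pad t∈))
∈-pad {ts = node minus _ ∷ _} (there t∈)  = there (there (∈-pad t∈))

-- A leaf is inserted only next to an original tree, so its property may be derived from the
-- presence of that tree.
All-pad : ∀ {P : STree → Set} {ts} → All P ts → (∀ {t} → t ∈ ts → ∀ s → P (leaf s)) → All P (pad ts)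
All-pad [] l = []
All-pad {ts = node plus _ ∷ _}  (p ∷ ps) l = p ∷ l (here refl) minus ∷ All-pad ps (l ∘ there)
All-pad {ts = node minus _ ∷ _} (p ∷ ps) l = l (here refl) plus ∷ p ∷ All-pad ps (l ∘ there)

-- The finite list of candidate trees.

module _ {A : Set} where

  -- The set S of the proof is selected by a predicate that depends on the interval. Listing all
  -- possible selections in advance keeps the candidate trees independent of it.
  sublists : List A → List (List A)
  sublists []       = [] ∷ []
  sublists (x ∷ xs) = sublists xs ++ map (x ∷_) (sublists xs)

  filter∈sublists : ∀ {P : A → Set} (P? : Decidable P) xs → filter P? xs ∈ sublists xs
  filter∈sublists P? []       = here refl
  filter∈sublists P? (x ∷ xs) with does (P? x)
  ... | true  = ∈-++⁺ʳ (sublists xs) (∈-map⁺ (x ∷_) (filter∈sublists P? xs))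
  ... | false = ∈-++⁺ˡ (filter∈sublists P? xs)

  All-sublists : ∀ {P : A → Set} {xs} → All P xs → All (All P) (sublists xs)
  All-sublists []       = [] ∷ []
  All-sublists (p ∷ ps) = All.++⁺ (All-sublists ps) (All.map⁺ (All.map (p ∷_) (All-sublists ps)))

padNode : Sign → List STree → STree
padNode s S = node s (pad S)

-- The index is a rank: each step permits one further level of ω- or ω*-sums. Finiteness of the list
-- is what yields a common threshold in `all-late-from`.
trees : ℕ → List STree
trees zero    = []
trees (suc n) = trees n ++ cartesianProductWith padNode (plus ∷ minus ∷ []) (sublists (trees n))

sign∈ : ∀ s → s ∈ plus ∷ minus ∷ []
sign∈ plus  = here refl
sign∈ minus = there (here refl)

trees-alternating : ∀ n → All Alternating (trees n)
trees-alternating zero    = []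
trees-alternating (suc n) = All.++⁺ (trees-alternating n)
  (All.cartesianProductWith⁺ (setoid _) (setoid _) padNode (plus ∷ minus ∷ []) (sublists (trees n))
    λ {_} {S} _ S∈ → pad-even S , pad-alternating (All.lookup (All-sublists (trees-alternating n)) S∈))

node∈trees : ∀ {n S} s → S ∈ sublists (trees n) → node s (pad S) ∈ trees (suc n)
node∈trees {n} s S∈ = ∈-++⁺ʳ (trees n) (∈-cartesianProductWith⁺ padNode (sign∈ s) S∈)

-- Graded orders and recurring suborders.

-- Orders graded by ω^s: the members of degree n are the n-th summand of an ω^s-sum.
record Graded (s : Sign) : Set₁ where
  field
    ord  : Ord
    deg  : Car ord → ℕ
    resp : ∀ x y → lt (Ω s) (deg x) (deg y) → lt ord x y

open Graded

module _ {s : Sign} where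

  fiber : Graded s → ℕ → Ord
  fiber Y n = mkOrd (Σ (Car (ord Y)) λ y → deg Y y ≡ n) (λ y z → lt (ord Y) (proj₁ y) (proj₁ z))

  FitsIn : Graded s → Ord → ℕ → ℕ → Set
  FitsIn X A a b = Σ (A ≼ ord X) λ f → ∀ x → a ≤ deg X (to f x) × deg X (to f x) < b

  -- The bound `b` on the degrees used leaves room beyond it, so copies can be laid out one after
  -- another.
  Recurs : Graded s → Ord → Set
  Recurs X A = ∀ a → ∃ λ b → a ≤ b × FitsIn X A a b

  recurs-≼ : ∀ {X A B} → A ≼ B → Recurs X B → Recurs X A
  recurs-≼ e r a with b , a≤b , f , bd ← r a = b , a≤b , ≼-trans e f , λ x → bd (to e x)

  recurs-empty : ∀ {X} → Recurs X emptyOrd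
  recurs-empty a = a , ≤-refl , emb (λ ()) (λ ()) , λ ()

recurs-⊕ : ∀ {s} {X : Graded s} {A B} → Recurs X A → Recurs X B → Recurs X (A ⊕ B)
recurs-⊕ {plus} {X} r r′ a with b , a≤b , f , bf ← r a with c , b≤c , g , bg ← r′ b =
  c , ≤-trans a≤b b≤c , emb [ to f , to g ]′ (λ where
    (inj₁ x) (inj₁ y) p → mono f x y p
    (inj₁ x) (inj₂ y) p → resp X _ _ (≤-trans (proj₂ (bf x)) (proj₁ (bg y)))
    (inj₂ x) (inj₂ y) p → mono g x y p) , λ where
    (inj₁ x) → proj₁ (bf x) , ≤-trans (proj₂ (bf x)) b≤c
    (inj₂ x) → ≤-trans a≤b (proj₁ (bg x)) , proj₂ (bg x)
-- Larger degrees now lie further left, so the right summand is placed first and the left one beyond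
-- it.
recurs-⊕ {minus} {X} r r′ a with b , a≤b , g , bg ← r′ a with c , b≤c , f , bf ← r b =
  c , ≤-trans a≤b b≤c , emb [ to f , to g ]′ (λ where
    (inj₁ x) (inj₁ y) p → mono f x y p
    (inj₁ x) (inj₂ y) p → resp X _ _ (≤-trans (proj₂ (bg y)) (proj₁ (bf x)))
    (inj₂ x) (inj₂ y) p → mono g x y p) , λ where
    (inj₁ x) → ≤-trans a≤b (proj₁ (bf x)) , proj₂ (bf x)
    (inj₂ x) → proj₁ (bg x) , ≤-trans (proj₂ (bg x)) b≤c

recurs-sumLIN : ∀ {s} {X : Graded s} cs → All (λ t → Recurs X (LIN t)) cs → Recurs X (sumLIN cs)
recurs-sumLIN {X = X} []       []       = recurs-empty {X = X}
recurs-sumLIN {X = X} (c ∷ cs) (r ∷ rs) = recurs-⊕ {X = X} r (recurs-sumLIN {X = X} cs rs)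

recurs-body : ∀ {s} {X : Graded s} cs → Recurs X oneOrd → All (λ t → Recurs X (LIN t)) cs → Recurs X (body cs)
recurs-body         []       r _  = r
recurs-body {X = X} (c ∷ cs) _ rs = recurs-sumLIN {X = X} (c ∷ cs) rs

increasing : ∀ {f : ℕ → ℕ} → (∀ n → f n ≤ f (suc n)) → ∀ {m n} → m ≤ n → f m ≤ f n
increasing h {m} {n} m≤n with ℕ.m≤n⇒m<n∨m≡n m≤n
... | inj₂ refl = ≤-refl
increasing h {m} {suc n} _ | inj₁ (s≤s m≤n) = ≤-trans (increasing h m≤n) (h n)

-- The summands of Y are placed in successive disjoint ranges of degrees of X.
glue : ∀ {s} {Y X : Graded s} → (∀ x y → lt (ord Y) x y → ¬ lt (ord Y) y x) →
  (∀ n → Recurs X (fiber Y n)) → ord Y ≼ ord X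
glue {s} {Y} {X} asym r = emb (λ y → place (deg Y y) (y , refl)) place-mono
  where
  start : ℕ → ℕ
  start zero    = 0
  start (suc n) = proj₁ (r n (start n))
  start-mono : ∀ {m n} → m ≤ n → start m ≤ start n
  start-mono = increasing λ n → proj₁ (proj₂ (r n (start n)))
  fits : ∀ n → FitsIn X (fiber Y n) (start n) (start (suc n))
  fits n = proj₂ (proj₂ (r n (start n)))
  place : ∀ n → Car (fiber Y n) → Car (ord X)
  place n = to (proj₁ (fits n))
  far : ∀ {m n} y z → m < n → deg X (place m y) < deg X (place n z)
  far {m} {n} y z m<n = ≤-trans (proj₂ (proj₂ (fits m) y)) (≤-trans (start-mono m<n) (proj₁ (proj₂ (fits n) z)))
  same : ∀ {m n} y z (p : deg Y y ≡ m) (q : deg Y z ≡ n) → m ≡ n → lt (ord Y) y z →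
    lt (ord X) (place m (y , p)) (place n (z , q))
  same {m} y z p q refl l = mono (proj₁ (fits m)) (y , p) (z , q) l
  order : ∀ s m n → lt (Ω s) m n → (m < n × s ≡ plus) ⊎ (n < m × s ≡ minus)
  order plus  m n l = inj₁ (l , refl)
  order minus m n l = inj₂ (l , refl)
  Ω-far : ∀ {m n} y z → lt (Ω s) m n → lt (Ω s) (deg X (place m y)) (deg X (place n z))
  Ω-far {m} {n} y z l with order s m n l
  ... | inj₁ (m<n , refl) = far y z m<n
  ... | inj₂ (n<m , refl) = far z y n<m
  place-mono : ∀ y z → lt (ord Y) y z → lt (ord X) (place (deg Y y) (y , refl)) (place (deg Y z) (z , refl))
  place-mono y z l with connex (Ω-isSTO s) (deg Y y) (deg Y z)
  ... | inj₁ d        = resp X _ _ (Ω-far _ _ d)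
  ... | inj₂ (inj₁ e) = same y z refl refl e l
  ... | inj₂ (inj₂ d) = contradiction (resp Y _ _ d) (asym y z l)

product : ∀ s → Ord → Graded s
product s B = record { ord = Ω s ⊗ B ; deg = proj₁ ; resp = λ _ _ → inj₁ }

product-recurs : ∀ {s B} → Recurs (product s B) B
product-recurs a = suc a , ℕ.n≤1+n a , emb (a ,_) (λ _ _ p → inj₂ (refl , p)) , λ _ → ≤-refl , ≤-refl

product-fiber : ∀ {s B} n → fiber (product s B) n ≼ B
product-fiber {s} {B} n = emb (λ { ((_ , b) , _) → b }) λ where
  ((m , _) , refl) ((_ , _) , refl) (inj₁ l)       → contradiction l (irreflexive (Ω-isSTO s) m)
  ((_ , _) , refl) ((_ , _) , refl) (inj₂ (_ , l)) → l

-- All summands of the product are copies of the body, so a place for one copy arbitrarily far out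
-- suffices for `glue`.
LIN≼graded : ∀ {s} {X : Graded s} cs → Recurs X (body cs) → LIN (node s cs) ≼ ord X
LIN≼graded {s} {X} cs r = subst (_≼ ord X) (sym (LIN-node s cs))
  (glue {Y = product s (body cs)} {X} (λ _ _ → asym) λ n → recurs-≼ {X = X} (product-fiber {s} n) r)
  where open IsStrictTotalOrder (subst IsSTO (LIN-node s cs) (LIN-isSTO (node s cs))) using (asym)

graded≼LIN : ∀ {s} {Y : Graded s} cs → (∀ x y → lt (ord Y) x y → ¬ lt (ord Y) y x) →
  (∀ n → Recurs (product s (body cs)) (fiber Y n)) → ord Y ≼ LIN (node s cs)
graded≼LIN {s} {Y} cs asym r = subst (ord Y ≼_) (sym (LIN-node s cs))
  (glue {Y = Y} {product s (body cs)} asym r)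

-- Finite sums of points and trees.

-- The binary shape of the sums lets indecomposability be applied at each `⊕`.
data Built (Q : STree → Set) : Ord → Set₁ where
  point : Built Q oneOrd
  tree  : ∀ {t} → Q t → Built Q (LIN t)
  _∔_   : ∀ {A B} → Built Q A → Built Q B → Built Q (A ⊕ B)

built-map : ∀ {Q Q′ A} → (∀ {t} → Q t → Q′ t) → Built Q A → Built Q′ A
built-map f point    = point
built-map f (tree q) = tree (f q)
built-map f (b ∔ c)  = built-map f b ∔ built-map f c

built-isSTO : ∀ {Q A} → Built Q A → IsSTO A
built-isSTO point        = one-isSTO
built-isSTO (tree {t} _) = LIN-isSTO t
built-isSTO (b ∔ c)      = ⊕-isSTO (built-isSTO b) (built-isSTO c)

built-recurs : ∀ {s} {X : Graded s} {Q A} → Recurs X oneOrd → (∀ {t} → Q t → Recurs X (LIN t)) →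
  Built Q A → Recurs X A
built-recurs         one q point    = one
built-recurs         one q (tree p) = q p
built-recurs {X = X} one q (b ∔ c)  =
  recurs-⊕ {X = X} (built-recurs {X = X} one q b) (built-recurs {X = X} one q c)

-- `R` is kept apart from `A` so that decompositions of pieces can be added up while their trees are
-- compared with the whole.
Decomp : List STree → Ord → Ord → Set₁
Decomp ts R A = Σ Ord λ B → A ≼ B × Built (λ t → t ∈ ts × LIN t ≼ R) B

module _ {ts : List STree} {R : Ord} where

  decomp-≼ : ∀ {A A′} → A′ ≼ A → Decomp ts R A → Decomp ts R A′
  decomp-≼ e (B , f , b) = B , ≼-trans e f , b

  decomp-antichain : ∀ {A} → (∀ x y → ¬ lt A x y) → Decomp ts R A
  decomp-antichain h = oneOrd , antichain≼one h , point

  decomp-mono : ∀ {us R′ A} → (∀ {t} → t ∈ ts → t ∈ us) → R ≼ R′ → Decomp ts R A → Decomp us R′ A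
  decomp-mono ⊆ e (B , f , b) = B , f , built-map (λ (t∈ , g) → ⊆ t∈ , ≼-trans g e) b

  decomp-⊕ : ∀ {A A′} → Decomp ts R A → Decomp ts R A′ → Decomp ts R (A ⊕ A′)
  decomp-⊕ (B , f , b) (B′ , f′ , b′) = B ⊕ B′ , ⊕-mono f f′ , b ∔ b′

-- Convex subsets of `L`, read in either direction.

module _ (em : ExcludedMiddle 0ℓ) (L : LinOrder) (countable : Countable L) (discrete : Discrete L) where

  open LinOrder L using (isSTO) renaming (Carrier to C; _<_ to _⊏_)

  -- Under `minus` the order is read backwards, so lower and upper halves of a class share one
  -- argument. The suborders `sub` always keep the order of `L` itself.
  _⊏[_]_ : C → Sign → C → Set
  x ⊏[ s ] y = dir s _⊏_ x y

  _⊑[_]_ : C → Sign → C → Set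
  x ⊑[ s ] y = x ⊏[ s ] y ⊎ x ≡ y

  sto : ∀ s → IsSTO (mkOrd C (dir s _⊏_))
  sto s = dir-isSTO s isSTO

  irr : ∀ s {x} → ¬ x ⊏[ s ] x
  irr s = irreflexive (sto s) _

  ⊏-trans : ∀ s {x y z} → x ⊏[ s ] y → y ⊏[ s ] z → x ⊏[ s ] z
  ⊏-trans s = IsStrictTotalOrder.trans (sto s)

  ⊏-asym : ∀ s {x y} → x ⊏[ s ] y → ¬ y ⊏[ s ] x
  ⊏-asym s = IsStrictTotalOrder.asym (sto s)

  ⊏⊑-trans : ∀ s {x y z} → x ⊏[ s ] y → y ⊑[ s ] z → x ⊏[ s ] z
  ⊏⊑-trans s p (inj₁ q)    = ⊏-trans s p q
  ⊏⊑-trans s p (inj₂ refl) = p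

  ⊑⊏-trans : ∀ s {x y z} → x ⊑[ s ] y → y ⊏[ s ] z → x ⊏[ s ] z
  ⊑⊏-trans s (inj₁ p)    q = ⊏-trans s p q
  ⊑⊏-trans s (inj₂ refl) q = q

  ⊑-trans : ∀ s {x y z} → x ⊑[ s ] y → y ⊑[ s ] z → x ⊑[ s ] z
  ⊑-trans s (inj₁ p)    q = inj₁ (⊏⊑-trans s p q)
  ⊑-trans s (inj₂ refl) q = q

  ⊑⇒⋣ : ∀ s {x y} → x ⊑[ s ] y → ¬ y ⊏[ s ] x
  ⊑⇒⋣ s p q = irr s (⊑⊏-trans s p q)

  ⊏-or-⊒ : ∀ s x y → x ⊏[ s ] y ⊎ y ⊑[ s ] x
  ⊏-or-⊒ s x y with connex (sto s) x y
  ... | inj₁ p        = inj₁ p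
  ... | inj₂ (inj₁ p) = inj₂ (inj₂ (sym p))
  ... | inj₂ (inj₂ p) = inj₂ (inj₁ p)

  ⋢⇒⊒ : ∀ s {x y} → ¬ x ⊏[ s ] y → y ⊑[ s ] x
  ⋢⇒⊒ s {x} {y} ¬p with ⊏-or-⊒ s x y
  ... | inj₁ p = contradiction p ¬p
  ... | inj₂ q = q

  chain-⊑ : ∀ s (g : ℕ → C) → (∀ n → g n ⊏[ s ] g (suc n)) → ∀ {m n} → m ≤ n → g m ⊑[ s ] g n
  chain-⊑ s g h {m} {n} m≤n with ℕ.m≤n⇒m<n∨m≡n m≤n
  ... | inj₂ refl = inj₂ refl
  chain-⊑ s g h {m} {suc n} _ | inj₁ (s≤s m≤n) = inj₁ (⊑⊏-trans s (chain-⊑ s g h m≤n) (h n))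

  sub : (C → Set) → Ord
  sub P = mkOrd (Σ C P) (λ x y → proj₁ x ⊏ proj₁ y)

  sub-⊆ : ∀ {P Q} → (∀ x → P x → Q x) → sub P ≼ sub Q
  sub-⊆ h = emb (λ (x , p) → x , h x p) (λ _ _ l → l)

  Convex : (C → Set) → Set
  Convex P = ∀ {x y z} → P x → P z → x ⊏ y → y ⊏ z → P y

  convex-dir : ∀ s {P} → Convex P → ∀ {x y z} → P x → P z → x ⊏[ s ] y → y ⊏[ s ] z → P y
  convex-dir plus  c p q a b = c p q a b
  convex-dir minus c p q a b = c q p b a

  ∩-convex : ∀ {P Q} → Convex P → Convex Q → Convex (λ x → P x × Q x)
  ∩-convex c c′ (p , q) (p′ , q′) a b = c p p′ a b , c′ q q′ a b

  convex-from : ∀ s {P} → (∀ {x y z} → P x → P z → x ⊏[ s ] y → y ⊏[ s ] z → P y) → Convex P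
  convex-from plus  c p q a b = c p q a b
  convex-from minus c p q a b = c q p b a

  interval-convex : ∀ s {u v} → Convex (λ x → u ⊑[ s ] x × x ⊏[ s ] v)
  interval-convex s = convex-from s λ (l , _) (_ , l′) a b → inj₁ (⊑⊏-trans s l a) , ⊏-trans s b l′

  upper-convex : ∀ s {u} → Convex (λ x → u ⊑[ s ] x)
  upper-convex s = convex-from s λ l _ a _ → inj₁ (⊑⊏-trans s l a)

  sub-split : ∀ {P P₁ P₂} → (∀ x → P x → P₁ x ⊎ P₂ x) → (∀ x y → P₁ x → P₂ y → ¬ y ⊏ x) →
    sub P ≼ sub P₁ ⊕ sub P₂
  sub-split {P} {P₁} {P₂} side sep = emb f f-mono
    where
    f : Σ C P → Σ C P₁ ⊎ Σ C P₂
    f (x , p) = Sum.map (x ,_) (x ,_) (side x p)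
    f-mono : ∀ x y → proj₁ x ⊏ proj₁ y → lt (sub P₁ ⊕ sub P₂) (f x) (f y)
    f-mono (x , p) (y , q) l with side x p | side y q
    ... | inj₁ _ | inj₁ _ = l
    ... | inj₁ _ | inj₂ _ = tt
    ... | inj₂ a | inj₁ b = contradiction l (sep y x b a)
    ... | inj₂ _ | inj₂ _ = l

  -- Under `minus` the part that comes first in direction `s` is the right summand, hence the
  -- exchange.
  decomp-split : ∀ s {ts R P P₁ P₂} → (∀ x → P x → P₁ x ⊎ P₂ x) →
    (∀ x y → P₁ x → P₂ y → ¬ y ⊏[ s ] x) →
    Decomp ts R (sub P₁) → Decomp ts R (sub P₂) → Decomp ts R (sub P)
  decomp-split plus  side sep d₁ d₂ = decomp-≼ (sub-split side sep) (decomp-⊕ d₁ d₂)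
  decomp-split minus side sep d₁ d₂ =
    decomp-≼ (sub-split (λ x → Sum.swap ∘ side x) (λ x y p q → sep y x q p)) (decomp-⊕ d₂ d₁)

  -- Infinite intervals and discreteness.

  adjacent : ∀ s x → (∃ λ y → x ⊏[ s ] y) → ∃ λ y → x ⊏[ s ] y × (∀ z → x ⊏[ s ] z → ¬ z ⊏[ s ] y)
  adjacent plus  x h = proj₁ discrete x h
  adjacent minus x h with p , p⊏x , none ← proj₂ discrete x h = p , p⊏x , λ z a b → none z b a

  InfiniteBetween : Sign → C → C → Set
  InfiniteBetween s u v = Σ (ℕ → C) λ h →
    (∀ m n → h m ≡ h n → m ≡ n) × (∀ n → u ⊑[ s ] h n × h n ⊑[ s ] v)

  -- At most one term of an injective sequence equals u, so a tail of it avoids u.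
  avoid : ∀ s {u v} → InfiniteBetween s u v →
    Σ (ℕ → C) λ h → (∀ m n → h m ≡ h n → m ≡ n) × (∀ n → u ⊏[ s ] h n × h n ⊑[ s ] v)
  avoid s {u} {v} (h , inj , bd) with em {∃ λ m → h m ≡ u}
  ... | no ¬m = h , inj , λ n → strict n (proj₁ (bd n)) , proj₂ (bd n)
    where
    strict : ∀ n → u ⊑[ s ] h n → u ⊏[ s ] h n
    strict n (inj₁ p) = p
    strict n (inj₂ e) = contradiction (n , sym e) ¬m
  ... | yes (m , e) = (λ n → h (n + suc m)) , (λ a b → ℕ.+-cancelʳ-≡ (suc m) a b ∘ inj _ _) ,
      λ n → strict n (proj₁ (bd (n + suc m))) , proj₂ (bd (n + suc m))
    where
    strict : ∀ n → u ⊑[ s ] h (n + suc m) → u ⊏[ s ] h (n + suc m)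
    strict n (inj₁ p)  = p
    strict n (inj₂ e′) = contradiction (inj _ _ (trans (sym e′) (sym e)))
      λ q → ℕ.<⇒≢ (ℕ.m≤n+m (suc m) n) (sym q)

  -- Once `u` is avoided, its immediate neighbour in direction `s` still bounds every remaining
  -- term, as nothing lies between the two. Infinitude therefore survives the step, which can be
  -- repeated forever.
  advance : ∀ s {u v} → InfiniteBetween s u v → u ⊏[ s ] v × ∃ λ u′ → u ⊏[ s ] u′ × InfiniteBetween s u′ v
  advance s {u} {v} i with h , inj , bd ← avoid s i
    with u′ , u⊏u′ , none ← adjacent s u (h 0 , proj₁ (bd 0)) =
    ⊏⊑-trans s (proj₁ (bd 0)) (proj₂ (bd 0)) ,
    u′ , u⊏u′ , h , inj , λ n → ⋢⇒⊒ s (none (h n) (proj₁ (bd n))) , proj₂ (bd n)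

  chain-between : ∀ s {u v} → InfiniteBetween s u v →
    Σ (ℕ → C) λ g → (∀ n → g n ⊏[ s ] g (suc n)) × (∀ n → u ⊏[ s ] g n × g n ⊏[ s ] v)
  chain-between s {u} {v} i = g , g-step , λ n → ⊏⊑-trans s u⊏g₀ (chain-⊑ s g g-step {0} {n} z≤n) ,
    proj₁ (advance s (proj₂ (state n)))
    where
    state : ℕ → ∃ λ x → InfiniteBetween s x v
    -- One step is taken before the chain begins, so that already its first term lies strictly
    -- beyond `u`.
    state zero    = proj₁ (proj₂ (advance s i)) , proj₂ (proj₂ (proj₂ (advance s i)))
    state (suc n) = let _ , x , _ , j = advance s (proj₂ (state n)) in x , j
    g : ℕ → C
    g n = proj₁ (state n)
    u⊏g₀ : u ⊏[ s ] g 0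
    u⊏g₀ = proj₁ (proj₂ (proj₂ (advance s i)))
    g-step : ∀ n → g n ⊏[ s ] g (suc n)
    g-step n = proj₁ (proj₂ (proj₂ (advance s (proj₂ (state n)))))

  chain-mono : ∀ s (g : ℕ → C) → (∀ n → g n ⊏[ s ] g (suc n)) → ∀ m n → lt (Ω s) m n → g m ⊏ g n
  chain-mono plus  g h m n l = ⊏⊑-trans plus (h m) (chain-⊑ plus g h l)
  chain-mono minus g h m n l = ⊏⊑-trans minus (h n) (chain-⊑ minus g h l)

  -- An infinite interval may be entered from either end: successors taken from the left end give ω,
  -- predecessors taken from the right end give ω*.
  reorient : ∀ s τ {u v} → InfiniteBetween s u v →
    ∃ λ u′ → ∃ λ v′ → InfiniteBetween τ u′ v′ ×
      (∀ {x} → u′ ⊏[ τ ] x → x ⊏[ τ ] v′ → u ⊏[ s ] x × x ⊏[ s ] v)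
  reorient plus  plus  i = _ , _ , i , _,_
  reorient minus minus i = _ , _ , i , _,_
  reorient plus  minus (h , inj , bd) = _ , _ ,
    (h , inj , λ n → Sum.map₂ sym (proj₂ (bd n)) , Sum.map₂ sym (proj₁ (bd n))) , flip _,_
  reorient minus plus  (h , inj , bd) = _ , _ ,
    (h , inj , λ n → Sum.map₂ sym (proj₂ (bd n)) , Sum.map₂ sym (proj₁ (bd n))) , flip _,_

  Ω-between : ∀ s τ {u v} → InfiniteBetween s u v →
    Σ (ℕ → C) λ g → (∀ m n → lt (Ω τ) m n → g m ⊏ g n) × (∀ n → u ⊏[ s ] g n × g n ⊏[ s ] v)
  Ω-between s τ i with _ , _ , j , back ← reorient s τ i with g , step , bd ← chain-between τ j =
    g , chain-mono τ g step , λ n → back (proj₁ (bd n)) (proj₂ (bd n))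

  Ω≼⇒injective : ∀ τ {P} (e : Ω τ ≼ sub P) m n → proj₁ (to e m) ≡ proj₁ (to e n) → m ≡ n
  Ω≼⇒injective τ e m n eq with connex (Ω-isSTO τ) m n
  ... | inj₁ l        = contradiction (subst (proj₁ (to e m) ⊏_) (sym eq) (mono e m n l)) (irr plus)
  ... | inj₂ (inj₁ p) = p
  ... | inj₂ (inj₂ l) = contradiction (subst (_⊏ proj₁ (to e m)) (sym eq) (mono e n m l)) (irr plus)

  -- One half of a class.

  -- Here `D` plays the part of a class on the `s` side of `r`, and `bounded` is the induction
  -- hypothesis for pieces of `D` that stay below some element of `D` in direction `s`.
  module _ (s : Sign) {n : ℕ} {r : C} {D : C → Set} (convex : Convex D) (r⊑ : ∀ z → D z → r ⊑[ s ] z)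
    (bounded : ∀ {z} → D z → ∀ {E} → Convex E → (∀ w → E w → D w × w ⊑[ s ] z) →
      Decomp (trees n) (sub E) (sub E))
    where

    module _ (d₀ : ∃ D) (unbounded : ∀ z → D z → ∃ λ w → D w × z ⊏[ s ] w) where

      -- The cofinal sequence starts at `r`, which may lie outside `D`.
      Point : Set
      Point = Σ C λ x → x ≡ r ⊎ D x

      above : (x : Point) → ∃ λ y → D y × proj₁ x ⊏[ s ] y
      above (x , inj₂ d) = unbounded x d
      above (x , inj₁ refl) with w , dw , l ← unbounded (proj₁ d₀) (proj₂ d₀) =
        w , dw , ⊑⊏-trans s (r⊑ _ (proj₂ d₀)) l

      above₂ : (x y : Point) → ∃ λ z → D z × proj₁ x ⊏[ s ] z × proj₁ y ⊏[ s ] z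
      above₂ x y with z , dz , l ← above x | ⊏-or-⊒ s (proj₁ y) z
      ... | inj₁ l′ = z , dz , l , l′
      ... | inj₂ l′ with w , dw , l″ ← above y = w , dw , ⊏-trans s l (⊑⊏-trans s l′ l″) , l″

      code : C → ℕ
      code = proj₁ countable

      -- Cofinality comes from countability: stage `i` passes the element with code `i`, if `D` has
      -- one.
      next : ∀ i (x : Point) → ∃ λ y → D y × proj₁ x ⊏[ s ] y × (∀ z → D z → code z ≡ i → z ⊏[ s ] y)
      next i x with em {∃ λ z → D z × code z ≡ i}
      ... | no ¬z with y , dy , l ← above x = y , dy , l , λ z d e → contradiction (z , d , e) ¬z
      ... | yes (z , d , e) with y , dy , l , l′ ← above₂ x (z , inj₂ d) =
        y , dy , l , λ z′ _ e′ → subst (_⊏[ s ] y) (proj₂ countable z z′ (trans e (sym e′))) l′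

      points : ℕ → Point
      points zero    = r , inj₁ refl
      points (suc i) with y , dy , _ ← next i (points i) = y , inj₂ dy

      p : ℕ → C
      p i = proj₁ (points i)

      p-step : ∀ i → p i ⊏[ s ] p (suc i)
      p-step i = proj₁ (proj₂ (proj₂ (next i (points i))))

      p∈D : ∀ i → D (p (suc i))
      p∈D i = proj₁ (proj₂ (next i (points i)))

      p-mono : ∀ {i j} → i ≤ j → p i ⊑[ s ] p j
      p-mono = chain-⊑ s p p-step

      -- These are the blocks, half-open so that each point of `D` falls in exactly one.
      Q : ℕ → C → Set
      Q i z = D z × p i ⊑[ s ] z × z ⊏[ s ] p (suc i)

      locate : ∀ {z} → D z → ∃ λ i → Q i z
      -- Stage `code z` has already passed `z`, so the search goes downwards from there; it stops by
      -- index 0 because `r` bounds `D`.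
      locate {z} d = search (code z) (proj₂ (proj₂ (proj₂ (next (code z) (points (code z))))) z d refl)
        where
        search : ∀ i → z ⊏[ s ] p (suc i) → ∃ λ i → Q i z
        search i l with ⊏-or-⊒ s z (p i)
        search i       l | inj₂ m = i , d , m , l
        search zero    l | inj₁ m = contradiction m (⊑⇒⋣ s (r⊑ z d))
        search (suc i) l | inj₁ m = search i m

      Q-before : ∀ {i j z w} → i < j → Q i z → Q j w → z ⊏[ s ] w
      Q-before i<j (_ , _ , l) (_ , m , _) = ⊏⊑-trans s l (⊑-trans s (p-mono i<j) m)

      Tail : ℕ → C → Set
      Tail N z = ∃ λ i → N ≤ i × Q i z

      tail : ℕ → Graded s
      tail N = record
        { ord  = sub (Tail N)
        ; deg  = proj₁ ∘ proj₂
        ; resp = λ (_ , _ , _ , q) (_ , _ , _ , q′) → resp′ s q q′ Q-before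
        }
        where
        resp′ : ∀ s {i j z w} → Q i z → Q j w → (∀ {i j z w} → i < j → Q i z → Q j w → z ⊏[ s ] w) →
          lt (Ω s) i j → z ⊏ w
        resp′ plus  q q′ before l = before l q q′
        resp′ minus q q′ before l = before l q′ q

      whole : Graded s
      whole = tail 0

      Late : Ord → Set
      Late = Recurs whole

      degree< : ∀ {i b z} → Q i z → z ⊏[ s ] p b → i < b
      degree< {i} {b} (_ , l , _) m with ℕ.<-≤-connex i b
      ... | inj₁ i<b = i<b
      ... | inj₂ b≤i = contradiction m (⊑⇒⋣ s (⊑-trans s (p-mono b≤i) l))

      degree≥ : ∀ {i a z} → Q i z → p a ⊑[ s ] z → a ≤ i
      degree≥ {i} {a} (_ , _ , m) l with ℕ.<-≤-connex i a
      ... | inj₁ i<a = contradiction m (⊑⇒⋣ s (⊑-trans s (p-mono i<a) l))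
      ... | inj₂ a≤i = a≤i

      late-one : Late oneOrd
      -- The point `p (suc a)` opens block `suc a`; `p a` would not do, since `p 0` is `r` and need
      -- not be in `D`.
      late-one a = suc (suc a) , ℕ.m≤n+m a 2 ,
        point≼ (p (suc a) , suc a , z≤n , p∈D a , inj₂ refl , p-step (suc a)) ,
        λ _ → ℕ.n≤1+n a , ≤-refl

      -- An interval containing some LIN t is infinite, and by discreteness it contains both ω and ω*.
      late-leaf : ∀ {t} → Late (LIN t) → ∀ τ → Late (LIN (leaf τ))
      late-leaf {t} late τ = recurs-≼ {X = whole} leaf≼Ω late-Ω
        where
        leaf≼Ω : LIN (leaf τ) ≼ Ω τ
        leaf≼Ω = subst (_≼ Ω τ) (sym (LIN-node τ [])) (emb proj₁ λ where
          _ _ (inj₁ l)        → l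
          _ _ (inj₂ (_ , ())))
        module _ {a b} (1+a≤b : suc a ≤ b) (fit : FitsIn whole (LIN t) (suc a) b) where
          e : Ω (sign t) ≼ sub (Tail 0)
          e = ≼-trans (Ω≼LIN t) (proj₁ fit)
          infinite : InfiniteBetween s (p (suc a)) (p b)
          infinite = (λ k → proj₁ (to e k)) , Ω≼⇒injective (sign t) e , λ k →
            let _ , i , _ , _ , l , l′ = to e k in
            ⊑-trans s (p-mono (proj₁ (proj₂ fit _))) l ,
            inj₁ (⊏⊑-trans s l′ (p-mono (proj₂ (proj₂ fit _))))
          p∈D′ : ∀ {b} → suc a ≤ b → D (p b)
          p∈D′ {suc b} _ = p∈D b
          fits : FitsIn whole (Ω τ) a b
          fits with g , g-mono , g-bd ← Ω-between s τ infinite =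
            emb (λ k → g k , proj₁ (loc k) , z≤n , proj₂ (loc k)) g-mono ,
            λ k → ≤-trans (ℕ.n≤1+n a) (degree≥ (proj₂ (loc k)) (inj₁ (proj₁ (g-bd k)))) ,
                  degree< (proj₂ (loc k)) (proj₂ (g-bd k))
            where
            loc : ∀ k → ∃ λ i → Q i (g k)
            loc k = locate (convex-dir s convex (p∈D a) (p∈D′ 1+a≤b) (proj₁ (g-bd k)) (proj₂ (g-bd k)))
        late-Ω : Late (Ω τ)
        -- Starting from `suc a` makes both ends `p (suc a)` and `p b` members of `D`, so by
        -- convexity the chain between them stays in `D`.
        late-Ω a = let b , 1+a≤b , fit = late (suc a) in b , ≤-trans (ℕ.n≤1+n a) 1+a≤b , fits 1+a≤b fit

      -- Either blocks containing `LIN t` stop occurring, and the claim is vacuous beyond that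
      -- point, or they occur arbitrarily far out, and `LIN t` recurs, so that 0 serves as
      -- threshold.
      late-from : ∀ t → ∃ λ N → ∀ i → N ≤ i → LIN t ≼ sub (Q i) → Late (LIN t)
      late-from t with em {∃ λ N → ∀ i → N ≤ i → ¬ LIN t ≼ sub (Q i)}
      ... | yes (N , none) = N , λ i N≤i e → contradiction e (none i N≤i)
      ... | no ¬N = 0 , λ _ _ _ → late
        where
        late : Late (LIN t)
        late a with em {∃ λ i → a ≤ i × LIN t ≼ sub (Q i)}
        ... | no ¬i = contradiction (a , λ i a≤i e → ¬i (i , a≤i , e)) ¬N
        ... | yes (i , a≤i , e) = suc i , ≤-trans a≤i (ℕ.n≤1+n i) ,
          emb (λ x → proj₁ (to e x) , i , z≤n , proj₂ (to e x)) (mono e) , λ _ → a≤i , ≤-refl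

      all-late-from : ∀ ts → ∃ λ N → ∀ {t} → t ∈ ts → ∀ i → N ≤ i → LIN t ≼ sub (Q i) → Late (LIN t)
      all-late-from []       = 0 , λ ()
      all-late-from (t ∷ ts) with M , h ← late-from t | N , h′ ← all-late-from ts = M ⊔ N , λ where
        (here refl) i l → h i (≤-trans (ℕ.m≤m⊔n M N) l)
        (there t∈)  i l → h′ t∈ i (≤-trans (ℕ.m≤n⊔m M N) l)

      Late? : Decidable (Late ∘ LIN)
      Late? t = em

      S : List STree
      S = filter Late? (trees n)

      late-body : Late (body (pad S))
      -- If `S` is empty the body is a point, handled by `late-one`. Otherwise each added leaf
      -- accompanies a recurring tree, from which `late-leaf` obtains it.
      late-body = recurs-body {X = whole} (pad S) late-one
        (All-pad S-late λ {t} t∈ → late-leaf {t} (All.lookup S-late t∈))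
        where
        S-late : All (Late ∘ LIN) S
        S-late = All.all-filter Late? (trees n)

      Tail⊆D : ∀ N z → Tail N z → D z
      Tail⊆D N z (_ , _ , d , _) = d

      node≼D : LIN (node s (pad S)) ≼ sub D
      node≼D = ≼-trans (LIN≼graded {X = whole} (pad S) late-body) (sub-⊆ (Tail⊆D 0))

      Q-decomp : ∀ i → Decomp (trees n) (sub (Q i)) (sub (Q i))
      Q-decomp i = bounded (p∈D i) (∩-convex convex (interval-convex s)) (λ w (d , _ , l) → d , inj₁ l)

      Decomp-D : (C → Set) → Set₁
      Decomp-D P = Decomp (trees (suc n)) (sub D) (sub P)

      -- Beyond the threshold each tree in the decomposition of a block belongs to `S` and so embeds
      -- in one copy of the body. A whole block then fits into finitely many copies, and the product
      -- has infinitely many to offer.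
      tail≼node : ∃ λ N → sub (Tail N) ≼ LIN (node s (pad S))
      tail≼node with N , late ← all-late-from (trees n) =
        N , graded≼LIN {Y = tail N} (pad S) (λ _ _ → ⊏-asym plus) fiber-recurs
        where
        B : Graded s
        B = product s (body (pad S))
        fiber-recurs : ∀ i → Recurs B (fiber (tail N) i)
        fiber-recurs i with ℕ.<-≤-connex i N
        -- The tail has no elements of degree below `N`.
        ... | inj₁ i<N = recurs-≼ {X = B} (emb absurd λ x → ⊥-elim (absurd x)) (recurs-empty {X = B})
          where
          absurd : Car (fiber (tail N) i) → ⊥
          absurd ((_ , _ , N≤i , _) , refl) = ℕ.<⇒≱ i<N N≤i
        ... | inj₂ N≤i with _ , f , b ← Q-decomp i = recurs-≼ {X = B} (≼-trans fiber≼Q f)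
            (built-recurs {X = B} (recurs-≼ {X = B} (point≼ (body-inhabited (pad S))) (product-recurs {s}))
              (λ (t∈ , e) → recurs-≼ {X = B}
                (LIN≼body (∈-pad (∈-filter⁺ Late? t∈ (late t∈ i N≤i e)))) (product-recurs {s})) b)
          where
          fiber≼Q : fiber (tail N) i ≼ sub (Q i)
          fiber≼Q = emb (λ { ((z , _ , _ , q) , refl) → z , q })
            λ { ((_ , _ , _ , _) , refl) ((_ , _ , _ , _) , refl) l → l }

      -- The finitely many blocks before the tail are put back one by one, each with its own
      -- decomposition.
      descend : ∀ N → Decomp-D (Tail N) → Decomp-D (Tail 0)
      descend zero    d = d
      descend (suc N) d = descend N (decomp-split s side sep
        (decomp-mono (∈-++⁺ˡ) (sub-⊆ λ _ → proj₁) (Q-decomp N)) d)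
        where
        side : ∀ x → Tail N x → Q N x ⊎ Tail (suc N) x
        side x (i , N≤i , q) with ℕ.m≤n⇒m<n∨m≡n N≤i
        ... | inj₁ N<i  = inj₂ (i , N<i , q)
        ... | inj₂ refl = inj₁ q
        sep : ∀ x y → Q N x → Tail (suc N) y → ¬ y ⊏[ s ] x
        sep x y q (i , N<i , q′) = ⊏-asym s (Q-before N<i q q′)

      unbounded-decomp : Decomp-D D
      unbounded-decomp with N , e ← tail≼node =
        decomp-≼ (sub-⊆ λ z d → proj₁ (locate d) , z≤n , proj₂ (locate d))
          (descend N (_ , e , tree (node∈trees {n} s (filter∈sublists Late? (trees n)) , node≼D)))

    -- With a last element in direction `s`, `D` is itself a bounded piece; only without one is a
    -- new tree formed.
    half-decomp : Decomp (trees (suc n)) (sub D) (sub D)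
    half-decomp with em {∃ D}
    ... | no ¬d = decomp-antichain λ (x , d) _ _ → ¬d (x , d)
    ... | yes d₀ with em {∃ λ z → D z × (∀ w → D w → w ⊑[ s ] z)}
    ...   | yes (z , d , max) = decomp-mono ∈-++⁺ˡ ≼-refl (bounded d convex λ w d′ → d′ , max w d′)
    ...   | no ¬max = unbounded-decomp d₀ larger
      where
      larger : ∀ z → D z → ∃ λ w → D w × z ⊏[ s ] w
      larger z d with em {∃ λ w → D w × z ⊏[ s ] w}
      ... | yes w = w
      ... | no ¬w = contradiction (z , d , λ w d′ → ⋢⇒⊒ s λ l → ¬w (w , d′ , l)) ¬max

  -- Induction on the rank.

  ClassDecomp : ℕ → Set₁
  ClassDecomp n = ∀ {r D} → Convex D → (∀ z → D z → Sim L n z r) → Decomp (trees n) (sub D) (sub D)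

  CloseDecomp : ℕ → Set₁
  CloseDecomp n = ∀ {x y D} → Close L n x y → Convex D → (∀ z → D z → x ⊑[ plus ] z × z ⊑[ plus ] y) →
    Decomp (trees n) (sub D) (sub D)

  FinMeet-shrink : ∀ {R x y x′ y′} → x ⊑[ plus ] x′ → y′ ⊑[ plus ] y → FinMeet L R x y → FinMeet L R x′ y′
  FinMeet-shrink l l′ (reps , cov) = reps , λ z a b → cov z (⊑-trans plus l a) (⊑-trans plus b l′)

  Close-shrink : ∀ n {x y x′ y′} → x ⊑[ plus ] x′ → y′ ⊑[ plus ] y → Close L n x y → Close L n x′ y′
  Close-shrink zero    l l′ c        = FinMeet-shrink l l′ c
  Close-shrink (suc n) l l′ (inj₁ c) = inj₁ (Close-shrink n l l′ c)
  Close-shrink (suc n) l l′ (inj₂ c) = inj₂ (FinMeet-shrink l l′ c)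

  Sim-refl : ∀ n {x} → Sim L n x x
  Sim-refl zero    = refl
  Sim-refl (suc n) = inj₁ refl

  -- The interval between `r` and `y` is part of the one between `r` and `x`, so a finite cover of
  -- the latter still serves.
  Sim-shrink : ∀ n s {r x y} → Sim L n x r → r ⊏[ s ] y → y ⊏[ s ] x → Sim L n y r
  Sim-shrink zero    s     refl                  a b = contradiction b (⊏-asym s a)
  Sim-shrink (suc n) s     (inj₁ refl)           a b = contradiction b (⊏-asym s a)
  Sim-shrink (suc n) plus  (inj₂ (inj₁ (l , _))) a b = contradiction l (⊏-asym plus (⊏-trans plus a b))
  Sim-shrink (suc n) minus (inj₂ (inj₁ (_ , c))) a b = inj₂ (inj₁ (a , Close-shrink n (inj₁ b) (inj₂ refl) c))
  Sim-shrink (suc n) plus  (inj₂ (inj₂ (_ , c))) a b = inj₂ (inj₂ (a , Close-shrink n (inj₂ refl) (inj₁ b) c))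
  Sim-shrink (suc n) minus (inj₂ (inj₂ (l , _))) a b = contradiction l (⊏-asym minus (⊏-trans minus a b))

  Sim-convex : ∀ n {r} → Convex (λ x → Sim L n x r)
  Sim-convex n {r} {x} {y} {z} p q a b with connex isSTO y r
  ... | inj₁ l           = Sim-shrink n minus p l a
  ... | inj₂ (inj₁ refl) = Sim-refl n
  ... | inj₂ (inj₂ l)    = Sim-shrink n plus q l b

  -- If `z` lies strictly beyond `r` in direction `s`, the equivalence supplies closeness of the
  -- two; otherwise `D` has at most one point.
  towards-decomp : ∀ {n} s {r z D} → CloseDecomp n → Sim L (suc n) z r → Convex D →
    (∀ w → D w → r ⊑[ s ] w × w ⊑[ s ] z) → Decomp (trees n) (sub D) (sub D)
  towards-decomp {n} s {r} {z} {D} close sim cvx bd = go s sim bd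
    where
    degenerate : ∀ s → ¬ r ⊏[ s ] z → (∀ w → D w → r ⊑[ s ] w × w ⊑[ s ] z) → Decomp (trees n) (sub D) (sub D)
    degenerate plus  ¬l bd = decomp-antichain λ (x , d) (y , d′) l →
      ¬l (⊏⊑-trans plus (⊑⊏-trans plus (proj₁ (bd x d)) l) (proj₂ (bd y d′)))
    degenerate minus ¬l bd = decomp-antichain λ (x , d) (y , d′) l →
      ¬l (⊏⊑-trans minus (⊑⊏-trans minus (proj₁ (bd y d′)) l) (proj₂ (bd x d)))
    go : ∀ s → Sim L (suc n) z r → (∀ w → D w → r ⊑[ s ] w × w ⊑[ s ] z) → Decomp (trees n) (sub D) (sub D)
    go s     (inj₁ refl)           bd = degenerate s (irr s) bd
    go plus  (inj₂ (inj₁ (l , _))) bd = degenerate plus (⊏-asym plus l) bd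
    go plus  (inj₂ (inj₂ (_ , c))) bd = close c cvx bd
    go minus (inj₂ (inj₁ (_ , c))) bd = close c cvx λ w d →
      Sum.map₂ sym (proj₂ (bd w d)) , Sum.map₂ sym (proj₁ (bd w d))
    go minus (inj₂ (inj₂ (l , _))) bd = degenerate minus (⊏-asym minus l) bd

  class-suc : ∀ {n} → CloseDecomp n → ClassDecomp (suc n)
  class-suc {n} close {r} {D} cvx sim = decomp-split plus
    (λ x d → Sum.map (λ l → d , inj₁ l) (λ l → d , l) (⊏-or-⊒ plus x r))
    (λ x y (_ , l) (_ , l′) → ⊑⇒⋣ plus (⊑-trans plus (Sum.map₂ sym l) l′))
    (side minus) (side plus)
    where
    side : ∀ s → Decomp (trees (suc n)) (sub D) (sub λ x → D x × r ⊑[ s ] x)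
    side s = decomp-mono id (sub-⊆ λ _ → proj₁)
      (half-decomp s {n} (∩-convex cvx (upper-convex s)) (λ _ → proj₂) λ (d , _) cvx′ bd →
        towards-decomp s close (sim _ d) cvx′ λ w e → let (_ , l) , l′ = bd w e in l , l′)

  class-zero : ClassDecomp zero
  class-zero _ sim = decomp-antichain λ (x , d) (y , d′) l →
    irr plus (subst (x ⊏_) (trans (sim y d′) (sym (sim x d))) l)

  cover-decomp : ∀ {n} → ClassDecomp n → ∀ reps {D} → Convex D → (∀ z → D z → Any (Sim L n z) reps) →
    Decomp (trees n) (sub D) (sub D)
  cover-decomp cls [] cvx cov = decomp-antichain λ (x , d) _ _ → contradiction (cov x d) λ ()
  cover-decomp {n} cls (r ∷ reps) {D} cvx cov =
    decomp-split plus side sep (outer minus)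
      (decomp-split plus (λ _ → id) sep′ inner (outer plus))
    where
    Side : Sign → C → Set
    Side s x = D x × r ⊏[ s ] x × ¬ Sim L n x r
    Inner Rest : C → Set
    Inner x = D x × Sim L n x r
    Rest x = Inner x ⊎ Side plus x
    Side-convex : ∀ s → Convex (Side s)
    Side-convex s = convex-from s λ (d , l , ¬e) (d′ , _) a b →
      convex-dir s cvx d d′ a b , ⊏-trans s l a , λ e → ¬e (Sim-shrink n s e l a)
    side : ∀ x → D x → Side minus x ⊎ Rest x
    side x d with em {Sim L n x r}
    ... | yes e = inj₂ (inj₁ (d , e))
    ... | no ¬e with connex isSTO x r
    ...   | inj₁ l           = inj₁ (d , l , ¬e)
    ...   | inj₂ (inj₁ refl) = contradiction (Sim-refl n) ¬e
    ...   | inj₂ (inj₂ l)    = inj₂ (inj₂ (d , l , ¬e))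
    sep : ∀ x y → Side minus x → Rest y → ¬ y ⊏ x
    sep x y (_ , l , ¬e) (inj₁ (_ , e))     m = ¬e (Sim-shrink n minus e l m)
    sep x y (_ , l , _)  (inj₂ (_ , l′ , _)) m = ⊏-asym plus m (⊏-trans plus l l′)
    sep′ : ∀ x y → Inner x → Side plus y → ¬ y ⊏ x
    sep′ x y (_ , e) (_ , l , ¬e) m = ¬e (Sim-shrink n plus e l m)
    inner : Decomp (trees n) (sub D) (sub Inner)
    inner = decomp-mono id (sub-⊆ λ _ → proj₁) (cls (∩-convex cvx (Sim-convex n)) λ _ → proj₂)
    outer : ∀ s → Decomp (trees n) (sub D) (sub (Side s))
    outer s = decomp-mono id (sub-⊆ λ _ → proj₁)
      (cover-decomp cls reps (Side-convex s) λ x (d , _ , ¬e) → later ¬e (cov x d))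
      where
      later : ∀ {x} → ¬ Sim L n x r → Any (Sim L n x) (r ∷ reps) → Any (Sim L n x) reps
      later ¬e (here e)  = contradiction e ¬e
      later ¬e (there a) = a

  finMeet-decomp : ∀ {n x y D} → ClassDecomp n → FinMeet L (Sim L n) x y → Convex D →
    (∀ z → D z → x ⊑[ plus ] z × z ⊑[ plus ] y) → Decomp (trees n) (sub D) (sub D)
  finMeet-decomp cls (reps , cov) cvx bd =
    cover-decomp cls reps cvx λ z d → cov z (proj₁ (bd z d)) (proj₂ (bd z d))

  mutual
    class-decomp : ∀ n → ClassDecomp n
    class-decomp zero    = class-zero
    class-decomp (suc n) = class-suc (close-decomp n)

    close-decomp : ∀ n → CloseDecomp n
    close-decomp zero    c        = finMeet-decomp class-zero c
    close-decomp (suc n) (inj₁ c) cvx bd = decomp-mono ∈-++⁺ˡ ≼-refl (close-decomp n c cvx bd)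
    close-decomp (suc n) (inj₂ c) = finMeet-decomp (class-suc (close-decomp n)) c

  order-decomp : ∀ n → FinitelyManyClasses L n → Decomp (trees n) (toOrd L) (toOrd L)
  order-decomp n (reps , cov) = decomp-≼ (emb (_, tt) λ _ _ l → l)
    (decomp-mono id (emb proj₁ λ _ _ l → l)
      (cover-decomp (class-decomp n) reps {λ _ → ⊤} (λ _ _ _ _ → tt) λ z _ → cov z))

  ≼one⇒finite : toOrd L ≼ oneOrd → Finite L
  ≼one⇒finite e with em {C}
  ... | no ¬c = 0 , mk↔ₛ′ (λ c → contradiction c ¬c) (λ ()) (λ ()) (λ c → contradiction c ¬c)
  ... | yes c = 1 , mk↔ₛ′ (λ _ → zero) (λ _ → c) (λ { zero → refl ; (suc ()) }) λ x → same c x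
    where
    same : ∀ x y → x ≡ y
    same x y with connex isSTO x y
    ... | inj₁ l        = ⊥-elim (mono e x y l)
    ... | inj₂ (inj₁ p) = p
    ... | inj₂ (inj₂ l) = ⊥-elim (mono e y x l)

  built-summand : ∀ {Q A} → Infinite L → Indecomposable L → Built Q A → toOrd L ≼ A →
    ∃ λ t → Q t × toOrd L ≼ LIN t
  built-summand inf ind point    e = contradiction (≼one⇒finite e) inf
  built-summand inf ind (tree q) e = _ , q , e
  built-summand inf ind (b ∔ c)  e
    with ind (record { isSTO = built-isSTO b }) (record { isSTO = built-isSTO c })
             (≼⇒Emb isSTO (⊕-isSTO (built-isSTO b) (built-isSTO c)) e)
  ... | inj₁ f = built-summand inf ind b (Emb⇒≼ f)
  ... | inj₂ f = built-summand inf ind c (Emb⇒≼ f)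

theorem4p7 : ExcludedMiddle 0ℓ → (L : LinOrder) →
    Infinite L → Countable L → Discrete L → Indecomposable L →
    Scattered L → FiniteHausdorffRank L →
    Σ STree λ T → Alternating T × Equimorphic (toOrd L) (LIN T)
theorem4p7 em L inf cnt disc ind _ (n , classes)
  with B , L≼B , built ← order-decomp em L cnt disc n classes
  with t , (t∈ , t≼L) , L≼t ← built-summand em L cnt disc inf ind built L≼B =
  t , All.lookup (trees-alternating n) t∈ ,
  ≼⇒Emb (LinOrder.isSTO L) (LIN-isSTO t) L≼t , ≼⇒Emb (LIN-isSTO t) (LinOrder.isSTO L) t≼L
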